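{- Let $X=\{x_1,x_2\}$ be an alphabet and let $\mathcal{F}=\mathcal{F}(X)$ be the free group on $X$, equipped with a bi-order $\prec$. Let $W\in\mathcal{F}$ be a cyclically reduced nonperiodic word of length $>1$. Then $W$ has a cyclic permutation $W'=AD$ where: (1) $A$ is the maximal ascent of $W$ and $A$ is uniquely positioned in $W$; (2) if $D$ is not uniquely positioned in $W$, then $D$ appears as an internal subword of $A$; (3) if $\prec$ is the Magnus ordering on $\mathcal{F}$ (corresponding to $x_1\succ x_2\succ 1_\mathcal{F}$), then $D=1_\mathcal{F}$ if and only if $W$ is monotonic.
   Context: Words are over $X^*=X\cup X^{ -1}$; a word $y_1\cdots y_n$ is reduced if $y_i\neq y_{i+1}^{ -1}$ for all $i$, and cyclically reduced if moreover $y_1\neq y_n^{ -1}$. Words are identified with the elements of $\mathcal{F}$ they represent; $1_\mathcal{F}$ is the empty word; $|W|$ is the length. A bi-order on $\mathcal{F}$ is a total order invariant under both left and right multiplication. $W$ is periodic if $W=U^k$ for some cyclically reduced word $U$ and some $k>1$; nonperiodic otherwise. A subword of $W$ is a word $V$ with $W=SVU$ and $|W|=|S|+|V|+|U|$; it is a prefix if $S$ is empty, a suffix if $U$ is empty, and internal if both $S$ and $U$ are nonempty. If $W=UV$ with $U$ a prefix, then $VU$ is a cyclic permutation of $W$. $R_W$ denotes the set of cyclic permutations of $W$ and of $W^{ -1}$. A nontrivial reduced word $U$ is uniquely positioned in $W$ if $U$ is a prefix of exactly one element of $R_W$. A word $U$ is an ascent if every (nonempty) prefix and every (nonempty) suffix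 of $U$ (including $U$ itself) is $\succ 1_\mathcal{F}$. The maximal ascent of $W$ is the greatest (with respect to $\prec$) ascent among all subwords of elements of $R_W$. A word $y_1\cdots y_n$ is monotonic if either all $y_i\in X$ or all $y_i\in X^{ -1}$. Magnus ordering: let $\Lambda=\mathbb{Z}[[X_1,X_2]]$ be formal power series in non-commuting variables and $\mu:\mathcal{F}\to\Lambda$ the injective homomorphism with $\mu(x_i)=1+X_i$, $\mu(x_i^{ -1})=1-X_i+X_i^2-X_i^3+\cdots$. Elements of $\Lambda$ are written with terms ordered by increasing degree, and monomials of the same degree ordered lexicographically with $X_1\succ X_2$; two elements are compared by the coefficient of the first monomial at which they differ. Then $v\succ w$ in $\mathcal{F}$ iff $\mu(v)\succ\mu(w)$; this is a bi-order on $\mathcal{F}$.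
   Formalization: Two corrections, as the literal claim fails for the Magnus ordering: W' is a cyclic permutation of W or of W^{ -1} (counterexample x1^{ -1}x2^{ -1}), and in (2) D or D^{ -1} appears as an internal subword of A (counterexample x2x1x2x1^{ -1}). -}

module Defs where

open import Algebra.Bundles using (Group)
open import Data.Bool.Base using (if_then_else_)
open import Data.Fin.Base as Fin using (Fin)
import Data.Fin.Properties as Fin
open import Data.Integer.Base as ℤ using (ℤ; 0ℤ; 1ℤ; -1ℤ)
open import Data.List.Base using (List; []; _∷_; _++_; [_]; length; map; reverse; concat; replicate; head; last)
import Data.List.Properties as List
open import Data.List.Relation.Binary.Lex.Core using (Lex-<)
open import Data.List.Relation.Unary.All using (All; all?)
open import Data.List.Relation.Unary.Linked using (Linked)
open import Data.Maybe.Base using (just)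
open import Data.Nat.Base using (_<_; _>_)
open import Data.Product using (_×_; _,_; proj₂; ∃; ∃₂; ∃!)
open import Data.Sign.Base using (Sign; opposite)
open import Data.Sum.Base using (_⊎_)
open import Function.Base using (_∘_)
open import Function.Bundles using (_⇔_)
open import Level using (Level; 0ℓ; _⊔_)
open import Relation.Binary.Construct.Closure.Equivalence as EqC using (EqClosure)
open import Relation.Binary.Core using (Rel)
open import Relation.Binary.PropositionalEquality
  using (_≡_; _≢_; refl; sym; trans; cong; subst; subst₂; module ≡-Reasoning)
open import Relation.Binary.Structures using (IsStrictTotalOrder)
open import Relation.Nullary.Decidable.Core using (does)

private
  variable
    c ℓ ℓ′ : Level

------------------------------------------------------------------------
-- Words over X ∪ X⁻¹, where X = {x₁ , x₂}

-- (i , Sign.+) is the generator with index i, (i , Sign.-) its inverse;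
-- x₁ has index zero and x₂ has index suc zero.
Letter : Set
Letter = Fin 2 × Sign

inv : Letter → Letter
inv (i , s) = i , opposite s

Word : Set
Word = List Letter

infix 8 _⁻¹

_⁻¹ : Word → Word
w ⁻¹ = reverse (map inv w)

------------------------------------------------------------------------
-- The free group: words modulo insertion and deletion of y y⁻¹.
-- Every class contains exactly one reduced word, which represents it below.

infix 4 _↝_ _≈_

data _↝_ : Rel Word 0ℓ where
  cancel : ∀ u y v → u ++ y ∷ inv y ∷ v ↝ u ++ v

_≈_ : Rel Word 0ℓ
_≈_ = EqClosure _↝_

private
  inv-involutive : ∀ y → inv (inv y) ≡ y
  inv-involutive (i , Sign.+) = refl
  inv-involutive (i , Sign.-) = refl

  ++-congˡ : ∀ w {u v} → u ≈ v → w ++ u ≈ w ++ v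
  ++-congˡ w = EqC.gmap (w ++_) λ where
    (cancel u y v) →
      subst₂ _↝_ (List.++-assoc w u _) (List.++-assoc w u v) (cancel (w ++ u) y v)

  ++-congʳ : ∀ w {u v} → u ≈ v → u ++ w ≈ v ++ w
  ++-congʳ w = EqC.gmap (_++ w) λ where
    (cancel u y v) →
      subst₂ _↝_ (sym (List.++-assoc u _ w)) (sym (List.++-assoc u v w)) (cancel u y (v ++ w))

  ⁻¹-++ : ∀ u v → (u ++ v) ⁻¹ ≡ v ⁻¹ ++ u ⁻¹
  ⁻¹-++ u v = trans (cong reverse (List.map-++ inv u v)) (List.reverse-++ (map inv u) (map inv v))

  ⁻¹-involutive : ∀ w → (w ⁻¹) ⁻¹ ≡ w
  ⁻¹-involutive w = begin
    reverse (map inv (reverse (map inv w)))  ≡⟨ cong reverse (List.reverse-map inv (map inv w)) ⟩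
    reverse (reverse (map inv (map inv w)))  ≡⟨ List.reverse-involutive _ ⟩
    map inv (map inv w)                      ≡⟨ List.map-∘ w ⟨
    map (inv ∘ inv) w                        ≡⟨ List.map-cong inv-involutive w ⟩
    map (λ y → y) w                          ≡⟨ List.map-id w ⟩
    w                                        ∎
    where open ≡-Reasoning

  ⁻¹-cancel : ∀ u y v → (u ++ y ∷ inv y ∷ v) ⁻¹ ≡ v ⁻¹ ++ y ∷ inv y ∷ u ⁻¹
  ⁻¹-cancel u y v = begin
    (u ++ y ∷ inv y ∷ v) ⁻¹                     ≡⟨ ⁻¹-++ u _ ⟩
    ((y ∷ inv y ∷ []) ++ v) ⁻¹ ++ u ⁻¹          ≡⟨ cong (_++ u ⁻¹) (⁻¹-++ (y ∷ inv y ∷ []) v) ⟩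
    (v ⁻¹ ++ inv (inv y) ∷ inv y ∷ []) ++ u ⁻¹  ≡⟨ List.++-assoc (v ⁻¹) _ _ ⟩
    v ⁻¹ ++ inv (inv y) ∷ inv y ∷ u ⁻¹          ≡⟨ cong (λ z → v ⁻¹ ++ z ∷ inv y ∷ u ⁻¹) (inv-involutive y) ⟩
    v ⁻¹ ++ y ∷ inv y ∷ u ⁻¹                    ∎
    where open ≡-Reasoning

  ⁻¹-cong : ∀ {u v} → u ≈ v → u ⁻¹ ≈ v ⁻¹
  ⁻¹-cong = EqC.gmap _⁻¹ λ where
    (cancel u y v) →
      subst₂ _↝_ (sym (⁻¹-cancel u y v)) (sym (⁻¹-++ u v)) (cancel (v ⁻¹) y (u ⁻¹))

  ≡⇒≈ : ∀ {u v} → u ≡ v → u ≈ v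
  ≡⇒≈ refl = EqC.reflexive _↝_

  ≈-trans : ∀ {u v w} → u ≈ v → v ≈ w → u ≈ w
  ≈-trans = EqC.transitive _↝_

  ⁻¹-inverseʳ : ∀ w → w ++ w ⁻¹ ≈ []
  ⁻¹-inverseʳ []      = ≡⇒≈ refl
  ⁻¹-inverseʳ (y ∷ w) = ≈-trans (≡⇒≈ regroup)
    (≈-trans (++-congˡ [ y ] (++-congʳ [ inv y ] (⁻¹-inverseʳ w)))
             (EqC.return (cancel [] y [])))
    where
    regroup : y ∷ w ++ (y ∷ w) ⁻¹ ≡ y ∷ (w ++ w ⁻¹) ++ [ inv y ]
    regroup = cong (y ∷_) (trans (cong (w ++_) (⁻¹-++ [ y ] w)) (sym (List.++-assoc w _ _)))

  ⁻¹-inverseˡ : ∀ w → w ⁻¹ ++ w ≈ []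
  ⁻¹-inverseˡ w = subst (λ v → w ⁻¹ ++ v ≈ []) (⁻¹-involutive w) (⁻¹-inverseʳ (w ⁻¹))

freeGroup : Group 0ℓ 0ℓ
freeGroup = record
  { Carrier = Word
  ; _≈_     = _≈_
  ; _∙_     = _++_
  ; ε       = []
  ; _⁻¹     = _⁻¹
  ; isGroup = record
    { isMonoid = record
      { isSemigroup = record
        { isMagma = record
          { isEquivalence = EqC.isEquivalence _↝_
          ; ∙-cong        = λ {_} {v} {x} u≈v x≈y → ≈-trans (++-congʳ x u≈v) (++-congˡ v x≈y)
          }
        ; assoc = λ u v w → ≡⇒≈ (List.++-assoc u v w)
        }
      ; identity = (λ w → ≡⇒≈ refl) , (λ w → ≡⇒≈ (List.++-identityʳ w))
      }
    ; inverse = ⁻¹-inverseˡ , ⁻¹-inverseʳ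
    ; ⁻¹-cong = ⁻¹-cong
    }
  }

record IsBiOrder (G : Group c ℓ) (_≺_ : Rel (Group.Carrier G) ℓ′) : Set (c ⊔ ℓ ⊔ ℓ′) where
  open Group G using (_∙_) renaming (_≈_ to _≈ᴳ_)
  field
    isStrictTotalOrder : IsStrictTotalOrder _≈ᴳ_ _≺_
    ∙-monoˡ-≺          : ∀ z {x y} → x ≺ y → (z ∙ x) ≺ (z ∙ y)
    ∙-monoʳ-≺          : ∀ z {x y} → x ≺ y → (x ∙ z) ≺ (y ∙ z)

------------------------------------------------------------------------
-- Combinatorics of words.  These notions concern words letter by letter,
-- so they use _≡_ and are applied to reduced words.

Reduced : Word → Set
Reduced = Linked (λ y z → y ≢ inv z)

CyclicallyReduced : Word → Set
CyclicallyReduced W =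
  Reduced W × (∀ {y z} → head W ≡ just y → last W ≡ just z → y ≢ inv z)

Periodic : Word → Set
Periodic W = ∃₂ λ U k → CyclicallyReduced U × k > 1 × W ≡ concat (replicate k U)

Prefix Suffix Subword InternalSubword : Rel Word 0ℓ
Prefix          V W = ∃ λ U → W ≡ V ++ U
Suffix          V W = ∃ λ S → W ≡ S ++ V
Subword         V W = ∃₂ λ S U → W ≡ S ++ V ++ U
InternalSubword V W = ∃₂ λ S U → W ≡ S ++ V ++ U × S ≢ [] × U ≢ []

CyclicPermutation : Rel Word 0ℓ
CyclicPermutation W′ W = ∃₂ λ U V → W ≡ U ++ V × W′ ≡ V ++ U

infix 4 _∈R_

_∈R_ : Rel Word 0ℓ
Z ∈R W = CyclicPermutation Z W ⊎ CyclicPermutation Z (W ⁻¹)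

UniquelyPositioned : Rel Word 0ℓ
UniquelyPositioned U W =
  U ≢ [] × Reduced U × ∃! _≡_ (λ Z → Z ∈R W × Prefix U Z)

Monotonic : Word → Set
Monotonic W = All (λ y → proj₂ y ≡ Sign.+) W ⊎ All (λ y → proj₂ y ≡ Sign.-) W

module _ (_≺_ : Rel Word ℓ) where

  Ascent : Word → Set ℓ
  Ascent U = (∀ {P} → P ≢ [] → Prefix P U → [] ≺ P)
           × (∀ {S} → S ≢ [] → Suffix S U → [] ≺ S)

  AscentIn : Word → Word → Set ℓ
  AscentIn U W = Ascent U × (∃ λ Z → Z ∈R W × Subword U Z)

  IsMaximalAscent : Word → Word → Set ℓ
  IsMaximalAscent A W = AscentIn A W × (∀ {B} → AscentIn B W → B ≺ A ⊎ B ≈ A)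

------------------------------------------------------------------------
-- The Magnus ordering

-- The monomial X_{i₁} ⋯ X_{iₙ}, as its list of indices.
Monomial : Set
Monomial = List (Fin 2)

-- An element of ℤ[[X₁ , X₂]], as its family of coefficients.
Series : Set
Series = Monomial → ℤ

1# : Series
1# []      = 1ℤ
1# (_ ∷ _) = 0ℤ

-- The coefficient of m in f · g is the sum of f p * g q over all
-- factorisations m ≡ p ++ q; the recursion peels off p ≡ [].
infixl 7 _·_

_·_ : Series → Series → Series
(f · g) []      = f [] ℤ.* g []
(f · g) (i ∷ m) = f [] ℤ.* g (i ∷ m) ℤ.+ ((f ∘ (i ∷_)) · g) m

1+X : Fin 2 → Series
1+X i []          = 1ℤ
1+X i (j ∷ [])    = if does (j Fin.≟ i) then 1ℤ else 0ℤ
1+X i (_ ∷ _ ∷ _) = 0ℤ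

-- 1 - X + X² - X³ + ⋯
[1+X]⁻¹ : Fin 2 → Series
[1+X]⁻¹ i m = if does (all? (Fin._≟ i) m) then -1ℤ ℤ.^ length m else 0ℤ

μ : Word → Series
μ []                 = 1#
μ ((i , Sign.+) ∷ w) = 1+X i · μ w
μ ((i , Sign.-) ∷ w) = [1+X]⁻¹ i · μ w

-- m ⊏ n: the monomial m is written before n.  Within a degree the
-- lexicographically greater monomial comes first; as X₁ ≻ X₂, this is the
-- increasing lexicographic order on lists of indices.
infix 4 _⊏_ _<Λ_

_⊏_ : Rel Monomial 0ℓ
m ⊏ n = length m < length n ⊎ (length m ≡ length n × Lex-< _≡_ Fin._<_ m n)

_<Λ_ : Rel Series 0ℓ
f <Λ g = ∃ λ m → f m ℤ.< g m × (∀ {n} → n ⊏ m → f n ≡ g n)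

IsMagnusOrder : Rel Word ℓ → Set ℓ
IsMagnusOrder _≺_ = ∀ {u v} → u ≺ v ⇔ μ u <Λ μ v

module Submission where

-- Let A be the greatest of all subwords ("factors") of elements of R_W, and W′ = A D.
-- If a proper prefix or suffix of A were ≺ 1, deleting it would give a greater
-- factor, so A is an ascent; likewise every word following or preceding an
-- occurrence of A is ≺ 1, in particular all prefixes and suffixes of D.  A factor
-- A E A is impossible: E A ≺ 1 gives E⁻¹ ≻ A.  So is A F A⁻¹: both F and F⁻¹ would
-- be ≺ 1.  Hence two occurrences of A, or two of D unless one lies inside A, must
-- overlap, and an overlap yields a word both ≻ 1 and ≺ 1, or one equal to its inverse.  The
-- only delicate case is that of two occurrences of A together covering the cyclic
-- word W, which is handled by a Euclidean descent.
-- For the Magnus ordering, if D = 1 and A = S y U with y a negative letter, then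
-- U S is a factor whose linear part exceeds that of A; conversely, if A D is
-- monotonic, then the first letters of A and of D have the same sign, but the
-- former must be ≻ 1 and the latter ≺ 1.

open import Defs
open import Data.List.Base using ([]; _++_; length)
open import Data.Nat.Base using (_>_)
open import Data.Product using (_×_; ∃-syntax)
open import Data.Sum.Base using (_⊎_)
open import Function.Bundles using (_⇔_)
open import Relation.Binary.Core using (Rel)
open import Relation.Binary.PropositionalEquality using (_≡_)
open import Relation.Nullary.Negation using (¬_)

open import Algebra.Bundles using (Group)
import Algebra.Properties.Group freeGroup as FreeGroup
import Data.Fin.Base as Fin
import Data.Fin.Properties as Fin
open import Data.Fin.Patterns using (0F; 1F)
open import Data.Integer.Base as ℤ using (0ℤ; 1ℤ; -1ℤ)
import Data.Integer.Properties as ℤ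
open import Data.List.Base using (List; _∷_; [_]; map; concatMap; foldr; reverse; last)
open import Data.List.Membership.Propositional using (_∈_)
open import Data.List.Membership.Propositional.Properties
open import Data.List.Properties hiding (≡-dec)
open import Data.List.Relation.Binary.Lex.Core using (base; this; next)
open import Data.List.Relation.Binary.Permutation.Propositional using (↭-sym)
open import Data.List.Relation.Binary.Permutation.Propositional.Properties
  using (All-resp-↭; ↭-reverse)
open import Data.List.Relation.Unary.All as All using (All; []; _∷_)
import Data.List.Relation.Unary.All.Properties as All
open import Data.List.Relation.Unary.Any using (here; there)
open import Data.List.Relation.Unary.Linked as Linked using ([]; [-]; _∷_)
open import Data.Maybe.Base using (just)
open import Data.Nat.Base using (suc; _+_; _≤_; _<_; s≤s)
import Data.Nat.Properties as ℕ
open import Data.Product using (_,_; proj₁; proj₂; ∃₂)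
open import Data.Product.Properties using (≡-dec)
open import Data.Sign.Base as Sign using (Sign)
import Data.Sign.Properties as Sign
open import Data.Sum.Base using (inj₁; inj₂)
open import Function.Base using (_∘_)
open import Function.Bundles using (mk⇔; module Equivalence)
open import Level using (0ℓ)
import Relation.Binary.Construct.Closure.Equivalence as EqC
open import Relation.Binary.Definitions using (DecidableEquality; tri<; tri≈; tri>)
open import Relation.Binary.Structures using (IsStrictTotalOrder)
open import Relation.Binary.PropositionalEquality
  using (_≢_; refl; sym; trans; cong; cong₂; subst; isEquivalence; module ≡-Reasoning)
open import Relation.Nullary.Decidable using (Dec; yes; no)
open import Relation.Nullary.Negation using (contradiction)
open import Tactic.MonoidSolver using (solve)

-- Equations between concatenations

module _ {a} {X : Set a} where

  -- Levi's lemma. Every comparison of two occurrences in one word below is an instance of it, with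
  -- `e` the gap or the overlap.
  ++-split : ∀ (u : List X) {v} x {y} → u ++ v ≡ x ++ y →
             (∃[ e ] u ≡ x ++ e × y ≡ e ++ v) ⊎ (∃[ e ] x ≡ u ++ e × v ≡ e ++ y)
  ++-split u       []      eq = inj₁ (u , refl , sym eq)
  ++-split []      (b ∷ x) eq = inj₂ (b ∷ x , refl , eq)
  ++-split (a ∷ u) (b ∷ x) eq with ∷-injective eq
  ... | refl , eq′ with ++-split u x eq′
  ... | inj₁ (e , refl , eq″) = inj₁ (e , refl , eq″)
  ... | inj₂ (e , refl , eq″) = inj₂ (e , refl , eq″)

  ++-assoc₃ : ∀ (u v x y : List X) → u ++ v ++ x ++ y ≡ (u ++ v ++ x) ++ y
  ++-assoc₃ u v x y = solve (++-monoid X)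

  length-++⁻ : ∀ u {v : List X} → length (u ++ v) ≤ length v → u ≡ []
  length-++⁻ []      _  = refl
  length-++⁻ (x ∷ u) {v} le = contradiction
    (ℕ.<-≤-trans (s≤s (length-++-≤ʳ v {u})) le) (ℕ.<-irrefl refl)

  ++-shortˡ : ∀ u (v : List X) {w} → w ≡ u ++ v → length w ≤ length v → u ≡ []
  ++-shortˡ u v refl = length-++⁻ u

  ++-suffix : ∀ u {v : List X} x {y} → u ++ v ≡ x ++ y → length y ≤ length v →
              ∃[ z ] v ≡ z ++ y
  ++-suffix u x eq le with ++-split u x eq
  ... | inj₂ (e , _ , eq′)       = e , eq′
  ... | inj₁ (e , _ , refl) with refl ← length-++⁻ e le = [] , refl

  ++-injectiveʳ : ∀ u {v : List X} x {y} → u ++ v ≡ x ++ y → length v ≡ length y → v ≡ y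
  ++-injectiveʳ u x {y} eq len with ++-suffix u x eq (ℕ.≤-reflexive (sym len))
  ... | z , refl with refl ← length-++⁻ z {y} (ℕ.≤-reflexive len) = refl

-- Inverse words and reduced normal forms

inv-involutive : ∀ y → inv (inv y) ≡ y
inv-involutive (i , Sign.+) = refl
inv-involutive (i , Sign.-) = refl

⁻¹-++ : ∀ u v → (u ++ v) ⁻¹ ≡ v ⁻¹ ++ u ⁻¹
⁻¹-++ u v = trans (cong reverse (map-++ inv u v)) (reverse-++ (map inv u) (map inv v))

⁻¹-involutive : ∀ w → (w ⁻¹) ⁻¹ ≡ w
⁻¹-involutive []      = refl
⁻¹-involutive (y ∷ w) = begin
  ((y ∷ w) ⁻¹) ⁻¹           ≡⟨ cong _⁻¹ (⁻¹-++ [ y ] w) ⟩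
  (w ⁻¹ ++ [ inv y ]) ⁻¹    ≡⟨ ⁻¹-++ (w ⁻¹) [ inv y ] ⟩
  inv (inv y) ∷ (w ⁻¹) ⁻¹   ≡⟨ cong₂ _∷_ (inv-involutive y) (⁻¹-involutive w) ⟩
  y ∷ w                     ∎
  where open ≡-Reasoning

length-⁻¹ : ∀ w → length (w ⁻¹) ≡ length w
length-⁻¹ w = trans (length-reverse (map inv w)) (length-map inv w)

_≟ᴸ_ : DecidableEquality Letter
_≟ᴸ_ = ≡-dec Fin._≟_ Sign._≟_

-- Left multiplication by a letter, as a map on reduced words.
infixr 5 _◃_

_◃_ : Letter → Word → Word
y ◃ []      = [ y ]
y ◃ (z ∷ w) with y ≟ᴸ inv z
... | yes _ = w
... | no  _ = y ∷ z ∷ w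

◃-reduced : ∀ y {w} → Reduced w → Reduced (y ◃ w)
◃-reduced y {[]}    _ = [-]
◃-reduced y {z ∷ w} r with y ≟ᴸ inv z
... | yes _   = Linked.tail r
... | no  y≢z = y≢z ∷ r

◃-∷ : ∀ {y w} → Reduced (y ∷ w) → y ◃ w ≡ y ∷ w
◃-∷ {y} {[]}    _         = refl
◃-∷ {y} {z ∷ w} (y≢z ∷ _) with y ≟ᴸ inv z
... | yes y≡z = contradiction y≡z y≢z
... | no  _   = refl

◃-cancel : ∀ y {w} → Reduced w → y ◃ inv y ◃ w ≡ w
◃-cancel y {[]} _ with y ≟ᴸ inv (inv y)
... | yes _ = refl
... | no  p = contradiction (sym (inv-involutive y)) p
◃-cancel y {z ∷ w} r with inv y ≟ᴸ inv z
... | yes p rewrite trans (sym (inv-involutive y)) (trans (cong inv p) (inv-involutive z)) = ◃-∷ r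
... | no  _ with y ≟ᴸ inv (inv y)
...   | yes _ = refl
...   | no  p = contradiction (sym (inv-involutive y)) p

normalise : Word → Word
normalise = foldr _◃_ []

normalise-reduced : ∀ w → Reduced (normalise w)
normalise-reduced []      = []
normalise-reduced (y ∷ w) = ◃-reduced y (normalise-reduced w)

normalise-id : ∀ {w} → Reduced w → normalise w ≡ w
normalise-id {[]}    _ = refl
normalise-id {y ∷ w} r = trans (cong (y ◃_) (normalise-id (Linked.tail r))) (◃-∷ r)

normalise-cancel : ∀ u y v → normalise (u ++ y ∷ inv y ∷ v) ≡ normalise (u ++ v)
normalise-cancel []      y v = ◃-cancel y (normalise-reduced v)
normalise-cancel (z ∷ u) y v = cong (z ◃_) (normalise-cancel u y v)

-- Van der Waerden's argument: by `◃-cancel`, `y` and `inv y` act on reduced words as mutually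
-- inverse maps, so the image of the empty word depends only on the class in the free group.
normalise-cong : ∀ {u v} → u ≈ v → normalise u ≡ normalise v
normalise-cong = EqC.gfold isEquivalence normalise λ where
  (cancel u y v) → normalise-cancel u y v

reduced-≈[] : ∀ {w} → Reduced w → w ≈ [] → w ≡ []
reduced-≈[] r eq = trans (sym (normalise-id r)) (normalise-cong eq)

reduced⇒no-cancel : ∀ u {y v} → ¬ Reduced (u ++ y ∷ inv y ∷ v)
reduced⇒no-cancel []      {y} (y≢ ∷ _) = y≢ (sym (inv-involutive y))
reduced⇒no-cancel (z ∷ u) r = reduced⇒no-cancel u (Linked.tail r)

-- Expresses reducedness through the place of a cancelling pair, which `++-split` can follow through
-- a rotation.
no-cancel⇒reduced : ∀ w → (∀ u {y v} → w ≢ u ++ y ∷ inv y ∷ v) → Reduced w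
no-cancel⇒reduced []          _ = []
no-cancel⇒reduced (y ∷ [])    _ = [-]
no-cancel⇒reduced (y ∷ z ∷ w) h =
  (λ { refl → h [] (cong (λ t → inv z ∷ t ∷ w) (sym (inv-involutive z))) })
  ∷ no-cancel⇒reduced (z ∷ w) (λ u eq → h (y ∷ u) (cong (y ∷_) eq))

-- Cyclic permutations and R_W

cp-sym : ∀ {Z W} → CyclicPermutation Z W → CyclicPermutation W Z
cp-sym (U , V , eq , eq′) = V , U , eq′ , eq

cp-trans : ∀ {Y Z W} → CyclicPermutation Y Z → CyclicPermutation Z W → CyclicPermutation Y W
cp-trans (U′ , V′ , eq , refl) (U , V , refl , refl) with ++-split V U′ eq
... | inj₁ (E , refl , refl) = U ++ U′ , E , solve (++-monoid Letter) , solve (++-monoid Letter)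
... | inj₂ (E , refl , refl) = E , V′ ++ V , solve (++-monoid Letter) , solve (++-monoid Letter)

cp-⁻¹ : ∀ {Z W} → CyclicPermutation Z W → CyclicPermutation (Z ⁻¹) (W ⁻¹)
cp-⁻¹ (U , V , refl , refl) = V ⁻¹ , U ⁻¹ , ⁻¹-++ U V , ⁻¹-++ V U

cp-⁻¹ˡ : ∀ {Z W} → CyclicPermutation Z (W ⁻¹) → CyclicPermutation (Z ⁻¹) W
cp-⁻¹ˡ {Z} {W} c = subst (CyclicPermutation (Z ⁻¹)) (⁻¹-involutive W) (cp-⁻¹ c)

∈R-refl : ∀ {W} → W ∈R W
∈R-refl {W} = inj₁ ([] , W , refl , sym (++-identityʳ W))

∈R-sym : ∀ {Z W} → Z ∈R W → W ∈R Z
∈R-sym (inj₁ c) = inj₁ (cp-sym c)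
∈R-sym {Z} {W} (inj₂ c) =
  inj₂ (subst (λ w → CyclicPermutation w (Z ⁻¹)) (⁻¹-involutive W) (cp-⁻¹ (cp-sym c)))

∈R-trans : ∀ {Y Z W} → Y ∈R Z → Z ∈R W → Y ∈R W
∈R-trans (inj₁ c) (inj₁ d) = inj₁ (cp-trans c d)
∈R-trans (inj₁ c) (inj₂ d) = inj₂ (cp-trans c d)
∈R-trans (inj₂ c) (inj₁ d) = inj₂ (cp-trans c (cp-⁻¹ d))
∈R-trans {W = W} (inj₂ c) (inj₂ d) =
  inj₁ (subst (CyclicPermutation _) (⁻¹-involutive W) (cp-trans c (cp-⁻¹ d)))

∈R-rotate : ∀ U {V W} → (U ++ V) ∈R W → (V ++ U) ∈R W
∈R-rotate U {V} = ∈R-trans (inj₁ (U , V , refl , refl))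

∈R-⁻¹ : ∀ {Z W} → Z ∈R W → (Z ⁻¹) ∈R W
∈R-⁻¹ {Z} = ∈R-trans (inj₂ ([] , Z ⁻¹ , refl , sym (++-identityʳ (Z ⁻¹))))

cp-length : ∀ {Z W} → CyclicPermutation Z W → length Z ≡ length W
cp-length (U , V , refl , refl) = length-++-comm V U

∈R-length : ∀ {Z W} → Z ∈R W → length Z ≡ length W
∈R-length (inj₁ c)     = cp-length c
∈R-length {W = W} (inj₂ c) = trans (cp-length c) (length-⁻¹ W)

last-∷ʳ : ∀ (w : Word) y → last (w ++ [ y ]) ≡ just y
last-∷ʳ []          y = refl
last-∷ʳ (_ ∷ [])    y = refl
last-∷ʳ (_ ∷ z ∷ w) y = last-∷ʳ (z ∷ w) y

-- A cancelling pair in `V ++ U` lies inside `V`, inside `U`, or across the junction; in the last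
-- case it consists of the last and the first letter of `W`.
cp-no-cancel : ∀ {Z W} → CyclicallyReduced W → CyclicPermutation Z W →
               ∀ u {y v} → Z ≢ u ++ y ∷ inv y ∷ v
cp-no-cancel (red , ends) (U , V , refl , refl) u {y} {v} eq with ++-split V u eq
... | inj₂ (e , refl , refl) =
  reduced⇒no-cancel e (subst Reduced (++-assoc e _ V) red)
... | inj₁ ([] , refl , refl) = reduced⇒no-cancel [] red
... | inj₁ (_ ∷ [] , refl , refl) = ends refl
  (trans (cong last (sym (++-assoc (inv y ∷ v) u [ y ]))) (last-∷ʳ (inv y ∷ v ++ u) y)) refl
... | inj₁ (_ ∷ _ ∷ e , refl , refl) = reduced⇒no-cancel (U ++ u) (subst Reduced (sym (++-assoc U u _)) red)

∈R-reduced : ∀ {Z W} → CyclicallyReduced W → Z ∈R W → Reduced Z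
∈R-reduced cr (inj₁ c) = no-cancel⇒reduced _ (cp-no-cancel cr c)
-- Inversion turns a cancelling pair of `Z` into one of `Z ⁻¹`, which is a rotation of `W` itself.
∈R-reduced {Z} {W} cr (inj₂ c) = no-cancel⇒reduced Z λ u {y} {v} eq →
  cp-no-cancel cr (cp-⁻¹ˡ c) (v ⁻¹) {y} {u ⁻¹}
    (begin
      Z ⁻¹                                       ≡⟨ cong _⁻¹ eq ⟩
      (u ++ y ∷ inv y ∷ v) ⁻¹                    ≡⟨ ⁻¹-++ u _ ⟩
      ((y ∷ inv y ∷ []) ++ v) ⁻¹ ++ u ⁻¹         ≡⟨ cong (_++ u ⁻¹) (⁻¹-++ (y ∷ inv y ∷ []) v) ⟩
      (v ⁻¹ ++ inv (inv y) ∷ inv y ∷ []) ++ u ⁻¹ ≡⟨ ++-assoc (v ⁻¹) _ _ ⟩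
      v ⁻¹ ++ inv (inv y) ∷ inv y ∷ u ⁻¹         ≡⟨ cong (λ z → v ⁻¹ ++ z ∷ inv y ∷ u ⁻¹) (inv-involutive y) ⟩
      v ⁻¹ ++ y ∷ inv y ∷ u ⁻¹                   ∎)
  where open ≡-Reasoning

reduced-++⁻ˡ : ∀ u {v} → Reduced (u ++ v) → Reduced u
reduced-++⁻ˡ []          _       = []
reduced-++⁻ˡ (_ ∷ [])    _       = [-]
reduced-++⁻ˡ (_ ∷ z ∷ u) (p ∷ r) = p ∷ reduced-++⁻ˡ (z ∷ u) r

-- Factors of the cyclic word

infix 4 _⊑_

-- Since R_W is closed under rotation, every subword of an element is also a prefix of some element,
-- so prefixes suffice.
_⊑_ : Rel Word 0ℓ
B ⊑ W = ∃[ U ] (B ++ U) ∈R W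

⊑-++ˡ : ∀ B C {W} → (B ++ C) ⊑ W → B ⊑ W
⊑-++ˡ B C {W} (U , z) = C ++ U , subst (_∈R W) (++-assoc B C U) z

⊑-++ʳ : ∀ B C {W} → (B ++ C) ⊑ W → C ⊑ W
⊑-++ʳ B C {W} (U , z) = U ++ B ,
  subst (_∈R W) (++-assoc C U B) (∈R-rotate B (subst (_∈R W) (++-assoc B C U) z))

∈R⇒⊑ : ∀ {Z W} → Z ∈R W → Z ⊑ W
∈R⇒⊑ {Z} {W} z = [] , subst (_∈R W) (sym (++-identityʳ Z)) z

⊑-⁻¹ : ∀ {B W} → B ⊑ W → (B ⁻¹) ⊑ W
⊑-⁻¹ {B} {W} (U , z) = ⊑-++ʳ (U ⁻¹) (B ⁻¹) (∈R⇒⊑ (subst (_∈R W) (⁻¹-++ B U) (∈R-⁻¹ z)))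

⊑-reduced : ∀ {B W} → CyclicallyReduced W → B ⊑ W → Reduced B
⊑-reduced {B} cr (_ , z) = reduced-++⁻ˡ B (∈R-reduced cr z)

some-letter : ∀ {W} → length W > 1 → ∃[ y ] [ y ] ⊑ W
some-letter {y ∷ w} _ = y , w , ∈R-refl

-- Finite enumeration of R_W and of the factors

splits : Word → List (Word × Word)
splits []      = [ [] , [] ]
splits (y ∷ w) = ([] , y ∷ w) ∷ map (λ (u , v) → y ∷ u , v) (splits w)

∈-splits⁺ : ∀ u v → (u , v) ∈ splits (u ++ v)
∈-splits⁺ []      []      = here refl
∈-splits⁺ []      (_ ∷ _) = here refl
∈-splits⁺ (y ∷ u) v       = there (∈-map⁺ _ (∈-splits⁺ u v))

∈-splits⁻ : ∀ w {u v} → (u , v) ∈ splits w → w ≡ u ++ v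
∈-splits⁻ []      (here refl) = refl
∈-splits⁻ (y ∷ w) (here refl) = refl
∈-splits⁻ (y ∷ w) (there i) with ∈-map⁻ _ i
... | _ , j , refl = cong (y ∷_) (∈-splits⁻ w j)

rotations : Word → List Word
rotations w = map (λ (u , v) → v ++ u) (splits w)

∈-rotations⁺ : ∀ {Z W} → CyclicPermutation Z W → Z ∈ rotations W
∈-rotations⁺ (U , V , refl , refl) = ∈-map⁺ _ (∈-splits⁺ U V)

∈-rotations⁻ : ∀ {Z} W → Z ∈ rotations W → CyclicPermutation Z W
∈-rotations⁻ W i with ∈-map⁻ _ i
... | (U , V) , j , refl = U , V , ∈-splits⁻ W j , refl

conjugates : Word → List Word
conjugates W = rotations W ++ rotations (W ⁻¹)

∈-conjugates⁺ : ∀ {Z W} → Z ∈R W → Z ∈ conjugates W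
∈-conjugates⁺         (inj₁ c) = ∈-++⁺ˡ (∈-rotations⁺ c)
∈-conjugates⁺ {W = W} (inj₂ c) = ∈-++⁺ʳ (rotations W) (∈-rotations⁺ c)

∈-conjugates⁻ : ∀ {Z} W → Z ∈ conjugates W → Z ∈R W
∈-conjugates⁻ W i with ∈-++⁻ (rotations W) i
... | inj₁ j = inj₁ (∈-rotations⁻ W j)
... | inj₂ j = inj₂ (∈-rotations⁻ (W ⁻¹) j)

prefixes : Word → List Word
prefixes w = map proj₁ (splits w)

factors : Word → List Word
factors W = concatMap prefixes (conjugates W)

∈-factors⁺ : ∀ {B W} → B ⊑ W → B ∈ factors W
∈-factors⁺ {B} (U , z) =
  ∈-concat⁺′ (∈-map⁺ proj₁ (∈-splits⁺ B U)) (∈-map⁺ prefixes (∈-conjugates⁺ z))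

∈-factors⁻ : ∀ {B} W → B ∈ factors W → B ⊑ W
∈-factors⁻ W i with ∈-concat⁻′ (map prefixes (conjugates W)) i
... | _ , j , k with ∈-map⁻ prefixes k
... | Z , l , refl with ∈-map⁻ proj₁ j
... | (B , U) , m , refl = U , subst (_∈R W) (∈-splits⁻ Z m) (∈-conjugates⁻ W l)

prefix? : ∀ V W → Dec (Prefix V W)
prefix? []      w  = yes (w , refl)
prefix? (_ ∷ _) [] = no λ ()
prefix? (x ∷ v) (y ∷ w) with x ≟ᴸ y | prefix? v w
... | yes refl | yes (u , refl) = yes (u , refl)
... | yes refl | no  ¬p         = no λ { (u , refl) → ¬p (u , refl) }
... | no  x≢y  | _              = no λ { (u , refl) → x≢y refl }

-- Constructive substitute for asking whether all positions coincide: `R` does not depend on `x`, so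
-- a single exceptional `x` settles the matter.
search : ∀ {p q r} {P : Word → Set p} {Q : Word → Set q} {R : Set r} → (∀ x → Dec (P x)) →
         ∀ xs → (∀ {x} → x ∈ xs → P x → Q x ⊎ R) → (∀ {x} → x ∈ xs → P x → Q x) ⊎ R
search P? []       _ = inj₁ λ ()
search P? (x ∷ xs) h with search P? xs (h ∘ there) | P? x
... | inj₂ r  | _      = inj₂ r
... | inj₁ qs | no ¬px = inj₁ λ where
  (here refl) px → contradiction px ¬px
  (there i)      → qs i
... | inj₁ qs | yes px with h (here refl) px
...   | inj₁ qx = inj₁ λ where
  (here refl) _ → qx
  (there i)     → qs i
...   | inj₂ r  = inj₂ r

-- Signs of letters and monotonic words

HasSign : Sign → Letter → Set
HasSign s y = proj₂ y ≡ s

all-rotate : ∀ {s} U {V} → All (HasSign s) (U ++ V) → All (HasSign s) (V ++ U)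
all-rotate U h = All.++⁺ (All.++⁻ʳ U h) (All.++⁻ˡ U h)

all-⁻¹ : ∀ {s} w → All (HasSign s) w → All (HasSign (Sign.opposite s)) (w ⁻¹)
all-⁻¹ w h = All-resp-↭ (↭-sym (↭-reverse (map inv w)))
  (All.map⁺ (All.map (cong Sign.opposite) h))

monotonic-∈R : ∀ {Z W} → Z ∈R W → Monotonic W → Monotonic Z
monotonic-∈R (inj₁ (U , V , refl , refl)) (inj₁ h) = inj₁ (all-rotate U h)
monotonic-∈R (inj₁ (U , V , refl , refl)) (inj₂ h) = inj₂ (all-rotate U h)
monotonic-∈R {W = W} (inj₂ (U , V , eq , refl)) (inj₁ h) =
  inj₂ (all-rotate U (subst (All _) eq (all-⁻¹ W h)))
monotonic-∈R {W = W} (inj₂ (U , V , eq , refl)) (inj₂ h) =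
  inj₁ (all-rotate U (subst (All _) eq (all-⁻¹ W h)))

first-letter : ∀ {s V} → V ≢ [] → All (HasSign s) V → ∃[ i ] Prefix [ (i , s) ] V
first-letter V≢[] []                        = contradiction refl V≢[]
first-letter _    (_∷_ {i , _} {V} refl _) = i , V , refl

-- Linear part of the Magnus expansion

μ-constant : ∀ w → μ w [] ≡ 1ℤ
μ-constant []                 = refl
μ-constant ((i , Sign.+) ∷ w) = trans (ℤ.*-identityˡ _) (μ-constant w)
μ-constant ((i , Sign.-) ∷ w) = trans (ℤ.*-identityˡ _) (μ-constant w)

-- Both constant terms are 1, so the degree-one coefficients of a product add.
μ-linear-∷ : ∀ y w i → μ (y ∷ w) [ i ] ≡ μ [ y ] [ i ] ℤ.+ μ w [ i ]
μ-linear-∷ (j , Sign.+) w i rewrite μ-constant w | ℤ.*-identityˡ (μ w [ i ])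
  | ℤ.+-identityˡ (1+X j [ i ] ℤ.* 1ℤ) = ℤ.+-comm (μ w [ i ]) _
μ-linear-∷ (j , Sign.-) w i rewrite μ-constant w | ℤ.*-identityˡ (μ w [ i ])
  | ℤ.+-identityˡ ([1+X]⁻¹ j [ i ] ℤ.* 1ℤ) = ℤ.+-comm (μ w [ i ]) _

μ-linear-++ : ∀ u v i → μ (u ++ v) [ i ] ≡ μ u [ i ] ℤ.+ μ v [ i ]
μ-linear-++ []      v i = sym (ℤ.+-identityˡ _)
μ-linear-++ (y ∷ u) v i = begin
  μ (y ∷ u ++ v) [ i ]                              ≡⟨ μ-linear-∷ y (u ++ v) i ⟩
  μ [ y ] [ i ] ℤ.+ μ (u ++ v) [ i ]                ≡⟨ cong (λ c → μ [ y ] [ i ] ℤ.+ c) (μ-linear-++ u v i) ⟩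
  μ [ y ] [ i ] ℤ.+ (μ u [ i ] ℤ.+ μ v [ i ])       ≡⟨ ℤ.+-assoc (μ [ y ] [ i ]) _ _ ⟨
  (μ [ y ] [ i ] ℤ.+ μ u [ i ]) ℤ.+ μ v [ i ]       ≡⟨ cong (λ c → c ℤ.+ μ v [ i ]) (μ-linear-∷ y u i) ⟨
  μ (y ∷ u) [ i ] ℤ.+ μ v [ i ]                     ∎
  where open ≡-Reasoning

μ-linear-remove : ∀ S y U i → μ (S ++ y ∷ U) [ i ] ≡ μ [ y ] [ i ] ℤ.+ μ (U ++ S) [ i ]
μ-linear-remove S y U i = begin
  μ (S ++ y ∷ U) [ i ]                ≡⟨ μ-linear-++ S (y ∷ U) i ⟩
  μ S [ i ] ℤ.+ μ (y ∷ U) [ i ]       ≡⟨ ℤ.+-comm (μ S [ i ]) _ ⟩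
  μ (y ∷ U) [ i ] ℤ.+ μ S [ i ]       ≡⟨ μ-linear-++ (y ∷ U) S i ⟨
  μ (y ∷ U ++ S) [ i ]                ≡⟨ μ-linear-∷ y (U ++ S) i ⟩
  μ [ y ] [ i ] ℤ.+ μ (U ++ S) [ i ]  ∎
  where open ≡-Reasoning

⊏-singleton : ∀ {n i} → n ⊏ [ i ] → n ≡ [] ⊎ ∃[ j ] n ≡ [ j ] × j Fin.< i
⊏-singleton {[]}        _ = inj₁ refl
⊏-singleton {j ∷ []}    (inj₂ (_ , this j<i)) = inj₂ (j , refl , j<i)
⊏-singleton {j ∷ []}    (inj₂ (_ , next _ (base ())))
⊏-singleton {j ∷ []}    (inj₁ (s≤s ()))
⊏-singleton {_ ∷ _ ∷ _} (inj₁ (s≤s ()))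
⊏-singleton {_ ∷ _ ∷ _} (inj₂ (() , _))

-- The linear coefficients are additive, so they ignore the order of the letters.
<Λ-remove-negative : ∀ S i U → μ (S ++ (i , Sign.-) ∷ U) <Λ μ (U ++ S)
<Λ-remove-negative S i U = [ i ] , less , λ n⊏[i] → below (⊏-singleton n⊏[i])
  where
  coefficient : ∀ i → μ [ (i , Sign.-) ] [ i ] ≡ -1ℤ
  coefficient 0F = refl
  coefficient 1F = refl
  vanishes : ∀ {i j} → j Fin.< i → μ [ (i , Sign.-) ] [ j ] ≡ 0ℤ
  vanishes {1F} {0F} _        = refl
  vanishes {1F} {1F} (s≤s ())
  less : μ (S ++ (i , Sign.-) ∷ U) [ i ] ℤ.< μ (U ++ S) [ i ]
  less = subst (λ c → c ℤ.< μ (U ++ S) [ i ])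
    (sym (trans (μ-linear-remove S (i , Sign.-) U i)
                (cong (λ c → c ℤ.+ μ (U ++ S) [ i ]) (coefficient i))))
    -- After the rewriting the left side is `-1ℤ` plus the right side, which is `pred` of it by
    -- definition.
    (ℤ.i≤pred[j]⇒i<j ℤ.≤-refl)
  below : ∀ {n} → n ≡ [] ⊎ (∃[ j ] n ≡ [ j ] × j Fin.< i) →
          μ (S ++ (i , Sign.-) ∷ U) n ≡ μ (U ++ S) n
  below (inj₁ refl) = trans (μ-constant (S ++ (i , Sign.-) ∷ U)) (sym (μ-constant (U ++ S)))
  below (inj₂ (j , refl , j<i)) =
    trans (μ-linear-remove S (i , Sign.-) U j)
          (trans (cong (λ c → c ℤ.+ μ (U ++ S) [ j ]) (vanishes j<i)) (ℤ.+-identityˡ _))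

-- Signs of words in a bi-ordered free group

module BiOrder {ℓ} {_≺_ : Rel Word ℓ} (isBiOrder : IsBiOrder freeGroup _≺_) where

  open IsBiOrder isBiOrder
  open IsStrictTotalOrder isStrictTotalOrder
    using (compare; asym; irrefl; <-respˡ-≈; <-respʳ-≈; _<?_; module Eq)
    renaming (trans to ≺-trans)
  open Group freeGroup using (inverseˡ; inverseʳ)

  PositiveSuffixes NegativePrefixes : Word → Set ℓ
  PositiveSuffixes V = ∀ {S} → S ≢ [] → Suffix S V → [] ≺ S
  NegativePrefixes D = ∀ {P} → P ≢ [] → Prefix P D → P ≺ []

  signed : ∀ {V} → Reduced V → V ≢ [] → V ≺ [] ⊎ [] ≺ V
  signed {V} r V≢[] with compare V []
  ... | tri< lt _ _ = inj₁ lt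
  ... | tri≈ _ eq _ = contradiction (reduced-≈[] r eq) V≢[]
  ... | tri> _ _ gt = inj₂ gt

  ⁻¹-negative : ∀ {V} → [] ≺ V → (V ⁻¹) ≺ []
  ⁻¹-negative {V} pos =
    subst (_≺ []) (++-identityʳ (V ⁻¹)) (<-respʳ-≈ (inverseˡ V) (∙-monoˡ-≺ (V ⁻¹) pos))

  ⁻¹-positive : ∀ {V} → V ≺ [] → [] ≺ (V ⁻¹)
  ⁻¹-positive {V} neg =
    subst ([] ≺_) (++-identityʳ (V ⁻¹)) (<-respˡ-≈ (inverseˡ V) (∙-monoˡ-≺ (V ⁻¹) neg))

  -- A nontrivial element and its inverse lie on opposite sides of 1.
  self-inverse : ∀ {V} → Reduced V → V ≡ V ⁻¹ → V ≡ []
  self-inverse {[]}        _ _  = refl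
  self-inverse {V@(_ ∷ _)} r eq with signed r (λ ())
  ... | inj₁ neg = contradiction neg (asym (subst ([] ≺_) (sym eq) (⁻¹-positive neg)))
  ... | inj₂ pos = contradiction pos (asym (subst (_≺ []) (sym eq) (⁻¹-negative pos)))

  greatest : ∀ x xs → ∃[ m ] m ∈ x ∷ xs × (∀ {y} → y ∈ x ∷ xs → ¬ m ≺ y)
  greatest x [] = x , here refl , λ { (here refl) → irrefl Eq.refl }
  greatest x (y ∷ ys) with greatest y ys
  ... | m , m∈ , max with m <? x
  ...   | yes m≺x = x , here refl , λ where
    (here refl) → irrefl Eq.refl
    (there i)   → max i ∘ ≺-trans m≺x
  ...   | no  m⊀x = m , there m∈ , λ where
    (here refl) → m⊀x
    (there i)   → max i

  maximal-factor : ∀ W → ∃[ A ] A ⊑ W × (∀ {B} → B ⊑ W → ¬ A ≺ B)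
  -- The empty word is a factor, so the enumeration is nonempty and has a greatest entry.
  maximal-factor W with factors W in eq | ∈-factors⁺ {[]} {W} (W , ∈R-refl)
  ... | x ∷ xs | _ with greatest x xs
  ... | A , A∈ , max = A , ∈-factors⁻ W (subst (A ∈_) (sym eq) A∈)
                     , λ B⊑W → max (subst (_ ∈_) eq (∈-factors⁺ B⊑W))

  -- A pair of borders V, V′ of V D V′ = V′ D′ V is shortened as in Euclid's
  -- algorithm: if V′ = V Y, then Y = D T and V D T = T D′ V, because otherwise
  -- Y would be both a suffix of V′ and a prefix of D.
  mutual
    exchange : ∀ n {V V′ D D′} → length V + length V′ < n →
               PositiveSuffixes V → PositiveSuffixes V′ →
               NegativePrefixes D → NegativePrefixes D′ → length D ≡ length D′ →
               V ++ D ++ V′ ≡ V′ ++ D′ ++ V → D ≡ D′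
    exchange (suc n) {V} {V′} {D} {D′} (s≤s le) pos pos′ neg neg′ len eq with ++-split V V′ eq
    ... | inj₁ (Y , V≡ , eq′) = sym (exchange-step n {Y = Y}
      (subst (_≤ n) (ℕ.+-comm (length V) (length V′)) le) pos′ pos neg′ neg (sym len) V≡ eq′)
    ... | inj₂ (Y , V′≡ , eq′) = exchange-step n {Y = Y} le pos pos′ neg neg′ len V′≡ eq′

    exchange-step : ∀ n {V V′ D D′ Y} → length V + length V′ ≤ n →
                    PositiveSuffixes V → PositiveSuffixes V′ →
                    NegativePrefixes D → NegativePrefixes D′ → length D ≡ length D′ →
                    V′ ≡ V ++ Y → D ++ V′ ≡ Y ++ D′ ++ V → D ≡ D′
    -- Empty `D` is split off because `T` might then be no shorter than `V′`; equal lengths settle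
    -- this case.
    exchange-step n {D = []} {[]} _ _ _ _ _ _ _ _ = refl
    exchange-step n {V} {D = D} {D′} {Y = []} _ _ _ _ _ _ refl eq =
      ++-cancelʳ V D D′ (subst (λ v → D ++ v ≡ D′ ++ V) (++-identityʳ V) eq)
    exchange-step n {V} {D = D@(_ ∷ D₁)} {D′} {Y@(_ ∷ _)} le pos pos′ neg neg′ len refl eq
      with ++-split D Y eq
    ... | inj₁ (E , D≡ , _) =
      contradiction (pos′ (λ ()) (V , refl)) (asym (neg (λ ()) (E , D≡)))
    -- `T` is a suffix of `V′`, so its suffixes are positive, and it is shorter than `V′` because
    -- `D` is nonempty.
    ... | inj₂ (T , refl , eq′) = exchange n shorter
      pos (λ S≢[] (S , T≡) → pos′ S≢[]
        (V ++ D ++ S , trans (cong (λ t → V ++ D ++ t) T≡) (++-assoc₃ V D S _)))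
      neg neg′ len eq′
      where
      shorter : length V + length T < n
      shorter = ℕ.<-≤-trans (ℕ.+-monoʳ-< (length V)
        (ℕ.<-≤-trans (s≤s (length-++-≤ʳ T {D₁})) (length-++-≤ʳ (D ++ T) {V}))) le

  no-inverse-pair : ∀ {V W} → CyclicallyReduced W → (V ++ V ⁻¹) ⊑ W → V ≡ []
  no-inverse-pair {V} cr VV⁻¹⊑W =
    ++-conicalˡ V (V ⁻¹) (reduced-≈[] (⊑-reduced cr VV⁻¹⊑W) (inverseʳ V))

  -- If `B ⁻¹` reached beyond `E`, say `B ⁻¹ ≡ F ++ E`, then `F` would be a suffix of `B`, and so
  -- would `F ⁻¹` because `B ≡ E ⁻¹ ++ F ⁻¹`. Equal lengths make `F` self-inverse, hence empty.
  opposite-after : ∀ {W} → CyclicallyReduced W → ∀ B R E Q → ((B ++ E) ++ Q) ∈R W →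
              Q ++ B ++ E ≡ R ++ B ⁻¹ → ∃[ F ] E ≡ F ++ B ⁻¹
  opposite-after {W} cr B R E Q z eq with ++-split (Q ++ B) R (trans (++-assoc Q B E) eq)
  ... | inj₂ (F , _ , E≡)         = F , E≡
  ... | inj₁ (F , QB≡RF , B⁻¹≡FE) = [] , trans (cong (_++ E) (sym F≡[])) (sym B⁻¹≡FE)
    where
    B≡ : B ≡ E ⁻¹ ++ F ⁻¹
    B≡ = trans (sym (⁻¹-involutive B)) (trans (cong _⁻¹ B⁻¹≡FE) (⁻¹-++ F E))
    F-suffix : ∃[ G ] B ≡ G ++ F
    F-suffix = ++-suffix Q R QB≡RF (subst (length F ≤_) (length-⁻¹ B)
      (subst (λ b → length F ≤ length b) (sym B⁻¹≡FE) (length-++-≤ˡ F)))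
    F-reduced : Reduced F
    F-reduced = ⊑-reduced cr (⊑-++ʳ (proj₁ F-suffix) F
      (subst (_⊑ W) (proj₂ F-suffix) (⊑-++ˡ B E (⊑-++ˡ (B ++ E) Q (∈R⇒⊑ z)))))
    F≡[] : F ≡ []
    F≡[] = self-inverse F-reduced (++-injectiveʳ (proj₁ F-suffix) (E ⁻¹)
      (trans (sym (proj₂ F-suffix)) B≡) (sym (length-⁻¹ F)))

  -- An overlap of occurrences of B and B⁻¹ would be a self-inverse word.
  opposite : ∀ {W} → CyclicallyReduced W → ∀ B C {Z} → (B ++ C) ∈R W →
             CyclicPermutation Z (B ++ C) → Suffix (B ⁻¹) Z → ∃₂ λ F G → C ≡ F ++ B ⁻¹ ++ G
  opposite {W} cr B C z (P , Q , eq , refl) (R , eq′) with ++-split P B (sym eq)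
  ... | inj₁ (E , refl , refl)
    with F , refl ← opposite-after cr B R E Q (subst (_∈R W) eq z) eq′ = F , Q , ++-assoc F (B ⁻¹) Q
  -- The cut lies inside `B ≡ P ++ T`. Then `Z` ends both in `P` and in `P ⁻¹`, so `P` is empty and
  -- nothing is rotated.
  ... | inj₂ (T , refl , refl)
    with refl ← self-inverse
      (reduced-++⁻ˡ P (reduced-++⁻ˡ (P ++ T) (∈R-reduced cr z)))
      (++-injectiveʳ (T ++ C) (R ++ T ⁻¹)
        (trans eq′ (trans (cong (R ++_) (⁻¹-++ P T)) (sym (++-assoc R (T ⁻¹) (P ⁻¹)))))
        (sym (length-⁻¹ P)))
    with F , refl ← opposite-after cr T R C [] (subst (_∈R W) (sym (++-identityʳ (T ++ C))) z)
      (trans (sym (++-identityʳ (T ++ C))) eq′) =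
      F , [] , cong (F ++_) (sym (++-identityʳ (T ⁻¹)))

  -- Consequences of the maximality of `A`

  module Maximal {W} (cr : CyclicallyReduced W) (length>1 : length W > 1)
                 {A} (A⊑W : A ⊑ W) (max : ∀ {B} → B ⊑ W → ¬ A ≺ B) where

    -- Some letter is a factor, and it or its inverse exceeds the empty word.
    nonempty : A ≢ []
    nonempty refl with some-letter length>1
    ... | y , y⊑W with signed {[ y ]} [-] (λ ())
    ...   | inj₁ neg = max (⊑-⁻¹ y⊑W) (⁻¹-positive neg)
    ...   | inj₂ pos = max y⊑W pos

    positive-prefix : ∀ {P} → P ≢ [] → Prefix P A → [] ≺ P
    positive-prefix {P} P≢[] (Q , refl) with signed (⊑-reduced cr (⊑-++ˡ P Q A⊑W)) P≢[]
    ... | inj₁ neg = contradiction (∙-monoʳ-≺ Q neg) (max (⊑-++ʳ P Q A⊑W))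
    ... | inj₂ pos = pos

    positive-suffix : PositiveSuffixes A
    positive-suffix {S} S≢[] (Q , refl) with signed (⊑-reduced cr (⊑-++ʳ Q S A⊑W)) S≢[]
    ... | inj₁ neg = contradiction
      (subst ((Q ++ S) ≺_) (++-identityʳ Q) (∙-monoˡ-≺ Q neg)) (max (⊑-++ˡ Q S A⊑W))
    ... | inj₂ pos = pos

    negative-after : ∀ {F} → F ≢ [] → (A ++ F) ⊑ W → F ≺ []
    negative-after {F} F≢[] AF⊑W with signed (⊑-reduced cr (⊑-++ʳ A F AF⊑W)) F≢[]
    ... | inj₁ neg = neg
    ... | inj₂ pos = contradiction
      (subst (_≺ (A ++ F)) (++-identityʳ A) (∙-monoˡ-≺ A pos)) (max AF⊑W)

    negative-before : ∀ {F} → F ≢ [] → (F ++ A) ⊑ W → F ≺ []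
    negative-before {F} F≢[] FA⊑W with signed (⊑-reduced cr (⊑-++ˡ F A FA⊑W)) F≢[]
    ... | inj₁ neg = neg
    ... | inj₂ pos = contradiction (∙-monoʳ-≺ A pos) (max FA⊑W)

    -- E A is negative, so that A ≺ E⁻¹.
    no-repeat : ∀ E → ¬ (A ++ E ++ A) ⊑ W
    no-repeat E AEA⊑W = max (⊑-⁻¹ (⊑-++ˡ E A EA⊑W))
      (subst (A ≺_) (++-identityʳ (E ⁻¹))
        (<-respˡ-≈ (FreeGroup.\\-leftDividesʳ E A) (∙-monoˡ-≺ (E ⁻¹) EA≺[])))
      where
      EA⊑W : (E ++ A) ⊑ W
      EA⊑W = ⊑-++ʳ A (E ++ A) AEA⊑W
      EA≺[] : (E ++ A) ≺ []
      EA≺[] = negative-after (nonempty ∘ ++-conicalʳ E A) AEA⊑W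

    -- Both F and F⁻¹ follow an occurrence of A, hence would be negative.
    no-inverse : ∀ F → ¬ (A ++ F ++ A ⁻¹) ⊑ W
    no-inverse [] AA⁻¹⊑W = nonempty (no-inverse-pair cr AA⁻¹⊑W)
    no-inverse F@(_ ∷ _) AFA⁻¹⊑W =
      asym (negative-after F⁻¹≢[] AF⁻¹⊑W)
           (⁻¹-positive (negative-after (λ ()) (⊑-++ˡ (A ++ F) (A ⁻¹)
             (subst (_⊑ W) (sym (++-assoc A F (A ⁻¹))) AFA⁻¹⊑W))))
      where
      F⁻¹≢[] : F ⁻¹ ≢ []
      F⁻¹≢[] eq with () ← trans (sym (length-⁻¹ F)) (cong length eq)
      AF⁻¹⊑W : (A ++ F ⁻¹) ⊑ W
      AF⁻¹⊑W = ⊑-++ˡ (A ++ F ⁻¹) (A ⁻¹) (subst (_⊑ W) (begin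
        (A ++ F ++ A ⁻¹) ⁻¹           ≡⟨ ⁻¹-++ A (F ++ A ⁻¹) ⟩
        (F ++ A ⁻¹) ⁻¹ ++ A ⁻¹        ≡⟨ cong (_++ A ⁻¹) (⁻¹-++ F (A ⁻¹)) ⟩
        ((A ⁻¹) ⁻¹ ++ F ⁻¹) ++ A ⁻¹   ≡⟨ cong (λ a → (a ++ F ⁻¹) ++ A ⁻¹) (⁻¹-involutive A) ⟩
        (A ++ F ⁻¹) ++ A ⁻¹           ∎) (⊑-⁻¹ AFA⁻¹⊑W))
        where open ≡-Reasoning

    -- Uniqueness of the position of `A`

    -- If `Q` contains `A`, then `A ++ E ++ A` is a factor, against `no-repeat`. Otherwise
    -- `A ≡ Q ++ V`; a proper overlap gives `A ≡ V ++ F` with `F` nonempty, and `Q ++ A ≡ A ++ F`,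
    -- so `F` is positive as a suffix of `A` and negative as a word following `A`.
    border : ∀ E Q {D′} → ((A ++ E) ++ Q) ∈R W → Q ++ A ++ E ≡ A ++ D′ → Q ≡ []
    border E Q z eq with ++-split Q A eq
    ... | inj₁ (E′ , refl , _) = contradiction
      (⊑-++ˡ (A ++ E ++ A) E′ (∈R⇒⊑ (subst (_∈R W)
        (trans (++-assoc A E (A ++ E′)) (++-assoc₃ A E A E′)) z)))
      (no-repeat E)
    ... | inj₂ (V , A≡QV , eq′) with ++-split A V eq′
    ...   | inj₂ (F , refl , _) =
      ++-shortˡ Q V A≡QV (length-++-≤ˡ A)
    ...   | inj₁ ([] , A≡V , _) =
      ++-shortˡ Q V A≡QV (ℕ.≤-reflexive (cong length (trans A≡V (++-identityʳ V))))
    ...   | inj₁ (F@(_ ∷ _) , A≡VF , _) = contradiction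
      (positive-suffix (λ ()) (V , A≡VF)) (asym (negative-after (λ ()) (⊑-++ˡ (A ++ F) E (∈R⇒⊑ AFE∈R))))
      where
      open ≡-Reasoning
      AFE∈R : ((A ++ F) ++ E) ∈R W
      AFE∈R = subst (_∈R W) (begin
        Q ++ A ++ E         ≡⟨ cong (λ a → Q ++ a ++ E) A≡VF ⟩
        Q ++ (V ++ F) ++ E  ≡⟨ solve (++-monoid Letter) ⟩
        ((Q ++ V) ++ F) ++ E  ≡⟨ cong (λ a → (a ++ F) ++ E) A≡QV ⟨
        (A ++ F) ++ E       ∎) (∈R-rotate (A ++ E) z)

    negative-prefix : ∀ {D} → (A ++ D) ∈R W → NegativePrefixes D
    negative-prefix AD∈R {P} P≢[] (Q , refl) = negative-after P≢[]
      (⊑-++ˡ (A ++ P) Q (∈R⇒⊑ (subst (_∈R W) (sym (++-assoc A P Q)) AD∈R)))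

    negative-suffix : ∀ {D S} → (A ++ D) ∈R W → S ≢ [] → Suffix S D → S ≺ []
    negative-suffix {S = S} AD∈R S≢[] (Q , refl) = negative-before S≢[]
      (⊑-++ʳ Q (S ++ A) (∈R⇒⊑ (subst (_∈R W) (++-assoc Q S A) (∈R-rotate A AD∈R))))

    -- If `P` or `Q` contains `A`, `border` makes the rotation trivial. Otherwise the two
    -- occurrences of `A` cover the cyclic word and overlap in `V` and `V′`, whence
    -- `A ≡ V ++ D ++ V′ ≡ V′ ++ D′ ++ V` and `exchange` applies. The words are compared, not the
    -- cuts, because unique positioning counts elements of R_W.
    rotation-unique : ∀ {D D′} P Q → (A ++ D) ∈R W → P ++ Q ≡ A ++ D → Q ++ P ≡ A ++ D′ →
                      A ++ D ≡ A ++ D′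
    rotation-unique {D} {D′} P Q AD∈R eq eq′ with ++-split P A eq | ++-split Q A eq′
    ... | inj₁ (E , refl , _) | _
      with refl ← border E Q (subst (_∈R W) (sym eq) AD∈R) eq′ =
        trans (sym eq) (trans (++-identityʳ (A ++ E)) eq′)
    ... | inj₂ _ | inj₁ (E , refl , _)
      with refl ← border E P (∈R-rotate P (subst (_∈R W) (sym eq) AD∈R)) eq =
        trans (sym eq) (trans (sym (++-identityʳ (A ++ E))) eq′)
    ... | inj₂ (V , A≡PV , refl) | inj₂ (V′ , A≡QV′ , refl) =
      cong (A ++_) (exchange _ ℕ.≤-refl
        (λ S≢[] (S , V≡) → positive-suffix S≢[]
          (P ++ S , trans A≡PV (trans (cong (P ++_) V≡) (sym (++-assoc P S _)))))
        (λ S≢[] (S , V≡) → positive-suffix S≢[]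
          (Q ++ S , trans A≡QV′ (trans (cong (Q ++_) V≡) (sym (++-assoc Q S _)))))
        (negative-prefix AD∈R) (negative-prefix AD′∈R)
        (ℕ.+-cancelˡ-≡ (length A) _ _ (trans (sym (length-++ A))
          (trans (trans (∈R-length AD∈R) (sym (∈R-length AD′∈R))) (length-++ A))))
        (trans (sym (++-assoc V D V′)) (trans (sym A≡QV′) (trans A≡PV (++-assoc V′ D′ V)))))
      where
      AD′∈R : (A ++ D′) ∈R W
      AD′∈R = subst (_∈R W) eq′ (∈R-rotate P (subst (_∈R W) (sym eq) AD∈R))

    position-unique : ∀ {D Z} → (A ++ D) ∈R W → Z ∈R W → Prefix A Z → A ++ D ≡ Z
    position-unique {D} AD∈R Z∈R (D′ , refl) with ∈R-trans Z∈R (∈R-sym AD∈R)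
    ... | inj₁ (P , Q , eq , eq′) = rotation-unique P Q AD∈R (sym eq) (sym eq′)
    -- Now `Z ⁻¹` is a rotation of `A ++ D` ending in `A ⁻¹`; `opposite` places this `A ⁻¹` inside
    -- `D`.
    ... | inj₂ c with opposite cr A D AD∈R (cp-⁻¹ˡ c) (D′ ⁻¹ , ⁻¹-++ A D′)
    ...   | F , G , refl = contradiction
      (⊑-++ˡ (A ++ F ++ A ⁻¹) G (∈R⇒⊑ (subst (_∈R W) (++-assoc₃ A F (A ⁻¹) G) AD∈R)))
      (no-inverse F)

    -- Further occurrences of `D`

    -- `D` is negative, whereas prefixes and suffixes of `A` are positive.
    internal : ∀ {D} E F → (A ++ D) ∈R W → D ≢ [] → A ≡ E ++ D ++ F → InternalSubword D A
    internal {D} []        F  AD∈R D≢[] A≡ =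
      contradiction (positive-prefix D≢[] (F , A≡))
                    (asym (negative-prefix AD∈R D≢[] ([] , sym (++-identityʳ D))))
    internal {D} E@(_ ∷ _) [] AD∈R D≢[] A≡ =
      contradiction (positive-suffix D≢[] (E , trans A≡ (cong (E ++_) (++-identityʳ D))))
                    (asym (negative-prefix AD∈R D≢[] ([] , sym (++-identityʳ D))))
    internal E@(_ ∷ _) F@(_ ∷ _) _ _ A≡ = E , F , A≡ , (λ ()) , λ ()

    -- Signs do not help here, since `D ⁻¹` is positive. But `D` is cyclically adjacent to both ends
    -- of `A`, so `D ⁻¹` at either end would cancel against it.
    internal⁻¹ : ∀ {D} E F → (A ++ D) ∈R W → D ≢ [] → A ≡ E ++ D ⁻¹ ++ F →
                 InternalSubword (D ⁻¹) A
    internal⁻¹ {D} []        F  AD∈R D≢[] refl = contradiction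
      (no-inverse-pair cr (⊑-++ˡ (D ++ D ⁻¹) F
        (∈R⇒⊑ (subst (_∈R W) (sym (++-assoc D (D ⁻¹) F)) (∈R-rotate A AD∈R)))))
      D≢[]
    internal⁻¹ {D} E@(_ ∷ _) [] AD∈R D≢[] refl = contradiction
      (no-inverse-pair {D ⁻¹} cr (subst (λ d → (D ⁻¹ ++ d) ⊑ W) (sym (⁻¹-involutive D)) D⁻¹D⊑W))
      λ D⁻¹≡[] → D≢[] (trans (sym (⁻¹-involutive D)) (cong _⁻¹ D⁻¹≡[]))
      where
      D⁻¹D⊑W : (D ⁻¹ ++ D) ⊑ W
      D⁻¹D⊑W = ⊑-++ʳ E (D ⁻¹ ++ D) (∈R⇒⊑ (subst (_∈R W)
        (trans (cong (λ d → (E ++ d) ++ D) (++-identityʳ (D ⁻¹))) (++-assoc E (D ⁻¹) D)) AD∈R))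
    internal⁻¹ E@(_ ∷ _) F@(_ ∷ _) _ _ A≡ = E , F , A≡ , (λ ()) , λ ()

    -- A second occurrence of `D` that is not inside `A` either overlaps the first in a word that is
    -- negative at an end of `D` and positive at an end of `A`, or contains all of `A`, against
    -- `no-repeat`.
    rotation-internal : ∀ {D R} P Q → (A ++ D) ∈R W → D ≢ [] → P ++ Q ≡ D ++ A → Q ++ P ≡ D ++ R →
                        Q ++ P ≡ D ++ A ⊎ InternalSubword D A
    rotation-internal {D} [] Q _ _ eq _ = inj₁ (trans (++-identityʳ Q) eq)
    rotation-internal {D} P [] _ _ eq _ = inj₁ (trans (sym (++-identityʳ P)) eq)
    rotation-internal {D} P@(_ ∷ _) Q@(_ ∷ _) AD∈R D≢[] eq eq′ with ++-split P D eq
    -- The second occurrence starts in `A`, at its suffix `Q`: it either fits into `Q` or begins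
    -- with all of `Q`.
    rotation-internal {D} P@(_ ∷ _) Q@(_ ∷ _) AD∈R D≢[] eq eq′ | inj₁ (E , _ , A≡EQ)
      with ++-split Q D eq′
    ... | inj₁ (F , Q≡DF , _) = inj₂ (internal E F AD∈R D≢[] (trans A≡EQ (cong (E ++_) Q≡DF)))
    ... | inj₂ (F , D≡QF , _) =
      contradiction (positive-suffix (λ ()) (E , A≡EQ)) (asym (negative-prefix AD∈R (λ ()) (F , D≡QF)))
    -- The second occurrence starts inside the first, at its suffix `T`, and runs on by `G` into or
    -- across the following `A`.
    rotation-internal {D} P@(_ ∷ _) Q@(_ ∷ _) AD∈R D≢[] eq eq′ | inj₂ (T , D≡PT , Q≡TA)
      with ++-split T D (trans (sym (++-assoc T A P)) (trans (cong (_++ P) (sym Q≡TA)) eq′))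
    ... | inj₁ (G , T≡DG , _) with () ← ++-shortˡ P T D≡PT
      (subst (λ t → length D ≤ length t) (sym T≡DG) (length-++-≤ˡ D))
    ... | inj₂ ([] , D≡T , _) with () ← ++-shortˡ P T D≡PT
      (ℕ.≤-reflexive (cong length (trans D≡T (++-identityʳ T))))
    ... | inj₂ (G@(_ ∷ _) , D≡TG , eq″) with ++-split A G eq″
    ...   | inj₁ (F , A≡GF , _) = contradiction
      (positive-prefix (λ ()) (F , A≡GF)) (asym (negative-suffix AD∈R (λ ()) (T , D≡TG)))
    ...   | inj₂ (F , G≡AF , _) = contradiction
      (⊑-++ˡ (A ++ T ++ A) F (∈R⇒⊑ (subst (_∈R W)
        (trans (cong (A ++_) (trans D≡TG (cong (T ++_) G≡AF))) (++-assoc₃ A T A F)) AD∈R)))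
      (no-repeat T)

    other-position-internal : ∀ {D Z} → (A ++ D) ∈R W → D ≢ [] → Z ∈R W → Prefix D Z →
                              Z ≡ D ++ A ⊎ InternalSubword D A ⊎ InternalSubword (D ⁻¹) A
    other-position-internal {D} AD∈R D≢[] Z∈R (R , refl)
      with ∈R-trans Z∈R (∈R-sym (∈R-rotate A AD∈R))
    ... | inj₁ (P , Q , eq , eq′) with rotation-internal P Q AD∈R D≢[] (sym eq) (sym eq′)
    ...   | inj₁ same = inj₁ (trans eq′ same)
    ...   | inj₂ int  = inj₂ (inj₁ int)
    -- As for `A`, but with `D` and `A` exchanged: `opposite` places `D ⁻¹` inside `A`.
    other-position-internal {D} AD∈R D≢[] Z∈R (R , refl) | inj₂ c
      with opposite cr D A (∈R-rotate A AD∈R) (cp-⁻¹ˡ c) (R ⁻¹ , ⁻¹-++ D R)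
    ... | F , G , A≡ = inj₂ (inj₂ (internal⁻¹ F G AD∈R D≢[] A≡))

    complement-internal : ∀ D → (A ++ D) ∈R W → ¬ UniquelyPositioned D W →
                          InternalSubword D A ⊎ InternalSubword (D ⁻¹) A
    -- Here `A` itself lies in R_W, so it has length at least two and the empty word sits between
    -- its first two letters.
    complement-internal [] A∈R _ = inj₁ (split-nonempty
      (subst (_> 1) (trans (sym (∈R-length A∈R)) (cong length (++-identityʳ A))) length>1))
      where
      split-nonempty : ∀ {V} → length V > 1 → InternalSubword [] V
      split-nonempty {x ∷ y ∷ V} _ = [ x ] , y ∷ V , refl , (λ ()) , λ ()
      split-nonempty {_ ∷ []} (s≤s ())
    complement-internal D@(_ ∷ _) AD∈R ¬unique
      -- R_W is finite, so the negated uniqueness yields an actual internal occurrence: if every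
      -- position gave `D ++ A`, then `D` would be uniquely positioned.
      with search (prefix? D) (conjugates W)
             (λ i → other-position-internal AD∈R (λ ()) (∈-conjugates⁻ W i))
    ... | inj₂ int    = int
    ... | inj₁ unique = contradiction
      ((λ ()) , ⊑-reduced cr (A , ∈R-rotate A AD∈R) , D ++ A , (∈R-rotate A AD∈R , A , refl)
      , λ { (Z∈R , D-prefix) → sym (unique (∈-conjugates⁺ Z∈R) D-prefix) })
      ¬unique

    -- The Magnus ordering and monotonic words

    module _ (magnus : IsMagnusOrder _≺_) where

      negative-letter : ∀ i → [ (i , Sign.-) ] ≺ []
      negative-letter i = Equivalence.from magnus (<Λ-remove-negative [] i [])

      positive-letter : ∀ i → [] ≺ [ (i , Sign.+) ]
      positive-letter i = ⁻¹-positive (negative-letter i)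

      -- Removing a negative letter from a rotation of A gives a larger factor.
      no-complement⇒positive : A ∈R W → All (HasSign Sign.+) A
      no-complement⇒positive A∈R = All.tabulate positive
        where
        positive : ∀ {y} → y ∈ A → HasSign Sign.+ y
        positive {_ , Sign.+} _ = refl
        positive {y@(i , Sign.-)} y∈A with S , U , A≡ ← ∈-∃++ y∈A = contradiction
          (subst (_≺ (U ++ S)) (sym A≡) (Equivalence.from magnus (<Λ-remove-negative S i U)))
          (max (⊑-++ʳ [ y ] (U ++ S) (∈R⇒⊑ (∈R-rotate S (subst (_∈R W) A≡ A∈R)))))

      monotonic⇒no-complement : ∀ D → (A ++ D) ∈R W → Monotonic (A ++ D) → D ≡ []
      monotonic⇒no-complement []        _    _        = refl
      monotonic⇒no-complement D@(_ ∷ _) AD∈R (inj₁ h)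
        with i , prefix ← first-letter (λ ()) (All.++⁻ʳ A h) =
        contradiction (positive-letter i) (asym (negative-prefix AD∈R (λ ()) prefix))
      monotonic⇒no-complement D@(_ ∷ _) AD∈R (inj₂ h)
        with i , prefix ← first-letter nonempty (All.++⁻ˡ A h) =
        contradiction (negative-letter i) (asym (positive-prefix (λ ()) prefix))

      no-complement⇔monotonic : ∀ D → (A ++ D) ∈R W → D ≡ [] ⇔ Monotonic W
      no-complement⇔monotonic D AD∈R = mk⇔
        (λ { refl → let A∈R = subst (_∈R W) (++-identityʳ A) AD∈R in
                    monotonic-∈R (∈R-sym A∈R) (inj₁ (no-complement⇒positive A∈R)) })
        (monotonic⇒no-complement D AD∈R ∘ monotonic-∈R AD∈R)

    -- Assembly of the claims

    maximal-ascent : IsMaximalAscent _≺_ A W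
    maximal-ascent =
      ( (positive-prefix , positive-suffix)
      , A ++ proj₁ A⊑W , proj₂ A⊑W , [] , proj₁ A⊑W , refl ) , greater
      where
      greater : ∀ {B} → AscentIn _≺_ B W → B ≺ A ⊎ B ≈ A
      greater {B} (_ , Z , Z∈R , S , U , refl) with compare B A
      ... | tri< B≺A _ _ = inj₁ B≺A
      ... | tri≈ _ B≈A _ = inj₂ B≈A
      ... | tri> _ _ A≺B = contradiction A≺B (max (⊑-++ˡ B U (⊑-++ʳ S (B ++ U) (∈R⇒⊑ Z∈R))))

    uniquely-positioned : UniquelyPositioned A W
    uniquely-positioned =
      nonempty , ⊑-reduced cr A⊑W , A ++ proj₁ A⊑W , (proj₂ A⊑W , proj₁ A⊑W , refl)
      , λ { (Z∈R , A-prefix) → position-unique (proj₂ A⊑W) Z∈R A-prefix }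

theorem3p2 : ∀ {ℓ} (_≺_ : Rel Word ℓ) → IsBiOrder freeGroup _≺_ →
    (W : Word) → CyclicallyReduced W → ¬ Periodic W → length W > 1 →
    ∃[ W′ ] ∃[ A ] ∃[ D ]
    ( W′ ∈R W
    × W′ ≡ A ++ D
    × (IsMaximalAscent _≺_ A W × UniquelyPositioned A W)
    × (¬ UniquelyPositioned D W → InternalSubword D A ⊎ InternalSubword (D ⁻¹) A)
    × (IsMagnusOrder _≺_ → (D ≡ [] ⇔ Monotonic W)))
theorem3p2 _≺_ isBiOrder W cr _ length>1
  -- `D` is whatever completes the chosen occurrence of `A` to an element of R_W.
  with A , A⊑W@(D , AD∈R) , max ← BiOrder.maximal-factor isBiOrder W =
  A ++ D , A , D , AD∈R , refl , (M.maximal-ascent , M.uniquely-positioned)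
  , M.complement-internal D AD∈R , λ magnus → M.no-complement⇔monotonic magnus D AD∈R
  where module M = BiOrder.Maximal isBiOrder cr length>1 A⊑W max
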